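{- For every integer $n\ge 1$, the lattice of noncrossing partitions $NC^A_n$ is a subposet of $P^A_n$, in the sense that $P^A_n$ is an extension of the refinement order: there exists a bijection $\varphi\colon NC^A_n\to P^A_n$ such that for all $\pi,\tau\in NC^A_n$, if $\pi<\tau$ in $NC^A_n$ then $\varphi(\pi)<\varphi(\tau)$ in $P^A_n$.
   Context: Let $[n]=\{1,2,\dots,n\}$. A set partition $\pi$ of $[n]$ is noncrossing if there are no four elements $1\le a<b<c<d\le n$ such that $a,c$ lie in one block of $\pi$ and $b,d$ lie in a different block of $\pi$. $NC^A_n$ is the set of noncrossing partitions of $[n]$ ordered by refinement: $\pi\le\nu$ if each block of $\nu$ is a union of blocks of $\pi$. A permutation $p=p_1p_2\cdots p_n$ of $[n]$ (one-line notation) is 132-avoiding if there are no positions $1\le a<b<c\le n$ with $p_a<p_c<p_b$. Its descent set is $\mathrm{Des}(p)=\{i\in[n-1] : p_i>p_{i+1}\}$. $P^A_n$ is the poset whose elements are the 132-avoiding permutations of $[n]$, with strict order $p<q$ if and only if $\mathrm{Des}(p)\subsetneq\mathrm{Des}(q)$ (so distinct permutations with the same descent set are incomparable). -}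

module Defs where

open import Data.Bool.Base using (Bool; true; false; T; _∧_)
open import Data.Bool.Properties using (T-∧)
open import Data.Fin.Base using (Fin; toℕ; _<_)
open import Data.Fin.Permutation as Perm using (Permutation′; _⟨$⟩ʳ_)
open import Data.Fin.Subset using (Subset; _∈_; _⊆_; Nonempty)
open import Data.Fin.Subset.Properties using (_⊆?_; ⊆-refl; ⊆-antisym)
open import Data.Nat.Base using (ℕ; suc)
open import Data.Product.Base using (Σ; ∃-syntax; _×_; _,_; proj₁; proj₂)
open import Function.Base using (id; _∘_; _on_)
open import Function.Bundles using (_⇔_; mk⇔; Equivalence)
open import Level using (0ℓ)
open import Relation.Binary.Bundles using (Poset; StrictPartialOrder)
open import Relation.Binary.Core using (Rel)
open import Relation.Binary.PropositionalEquality
  using (_≡_; _≢_; refl; sym; trans; subst; subst₂)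
import Relation.Binary.Properties.Poset as PosetProperties
open import Relation.Nullary.Decidable using (⌊_⌋; toWitness; fromWitness)
open import Relation.Nullary.Negation using (¬_; contradiction)
open import Relation.Unary using (Pred; _⊂_) renaming (_⊆_ to _⊆ᴾ_)

-- Throughout, [n] is Fin n: the element k ∈ {1,…,n} is the index k - 1, a
-- shift that changes neither order nor adjacency.

Family : ℕ → Set
Family n = Subset n → Bool

infix 4 _∈ᶠ_

_∈ᶠ_ : ∀ {n} → Subset n → Family n → Set
B ∈ᶠ 𝓑 = T (𝓑 B)

_IsUnionOf_ : ∀ {n} → Subset n → Family n → Set
C IsUnionOf 𝓕 = ∀ x → x ∈ C ⇔ (∃[ B ] B ∈ᶠ 𝓕 × x ∈ B)

record SetPartition (n : ℕ) : Set where
  field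
    blocks   : Family n
    nonempty : ∀ {B} → B ∈ᶠ blocks → Nonempty B
    cover    : ∀ x → ∃[ B ] B ∈ᶠ blocks × x ∈ B
    disjoint : ∀ {B C x} → B ∈ᶠ blocks → C ∈ᶠ blocks → x ∈ B → x ∈ C → B ≡ C

open SetPartition public

Crossing : ∀ {n} → SetPartition n → Set
Crossing {n} π =
  ∃[ a ] ∃[ b ] ∃[ c ] ∃[ d ] (a < b × b < c × c < d ×
    ∃[ B ] ∃[ C ] (B ∈ᶠ blocks π × C ∈ᶠ blocks π × B ≢ C ×
      a ∈ B × c ∈ B × b ∈ C × d ∈ C))

Noncrossing : ∀ {n} → SetPartition n → Set
Noncrossing π = ¬ Crossing π

-- Equality of set partitions is having the same blocks; the proof fields of
-- SetPartition and the proof of Noncrossing are not compared.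

_≈ᴾ_ : ∀ {n} → Rel (SetPartition n) 0ℓ
π ≈ᴾ ν = ∀ B → blocks π B ≡ blocks ν B

_≤ᴾ_ : ∀ {n} → Rel (SetPartition n) 0ℓ
π ≤ᴾ ν = ∀ C → C ∈ᶠ blocks ν →
  ∃[ 𝓕 ] (∀ B → B ∈ᶠ 𝓕 → B ∈ᶠ blocks π) × C IsUnionOf 𝓕

private
  module _ {n : ℕ} where

    _≼_ : Rel (SetPartition n) 0ℓ
    π ≼ ν = ∀ C → C ∈ᶠ blocks ν → ∀ x → x ∈ C →
      ∃[ B ] B ∈ᶠ blocks π × x ∈ B × B ⊆ C

    ≤⇒≼ : ∀ {π ν} → π ≤ᴾ ν → π ≼ ν
    ≤⇒≼ π≤ν C C∈ν x x∈C with π≤ν C C∈ν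
    ... | 𝓕 , 𝓕⊆π , ⋃𝓕 with Equivalence.to (⋃𝓕 x) x∈C
    ... | B , B∈𝓕 , x∈B =
      B , 𝓕⊆π B B∈𝓕 , x∈B , λ {y} y∈B → Equivalence.from (⋃𝓕 y) (B , B∈𝓕 , y∈B)

    ≼⇒≤ : ∀ {π ν} → π ≼ ν → π ≤ᴾ ν
    ≼⇒≤ {π} π≼ν C C∈ν =
      (λ B → blocks π B ∧ ⌊ B ⊆? C ⌋) ,
      (λ B → proj₁ ∘ Equivalence.to T-∧) ,
      λ x → mk⇔
        (λ x∈C → let B , B∈π , x∈B , B⊆C = π≼ν C C∈ν x x∈C in
          B , Equivalence.from T-∧ (B∈π , fromWitness {a? = B ⊆? C} B⊆C) , x∈B)
        (λ (B , B∈𝓕 , x∈B) →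
          toWitness {a? = B ⊆? C} (proj₂ (Equivalence.to (T-∧ {blocks π B}) B∈𝓕)) x∈B)

    ≼-reflexive : ∀ {π ν} → π ≈ᴾ ν → π ≼ ν
    ≼-reflexive π≈ν C C∈ν x x∈C = C , subst T (sym (π≈ν C)) C∈ν , x∈C , ⊆-refl

    ≼-trans : ∀ {π ν τ} → π ≼ ν → ν ≼ τ → π ≼ τ
    ≼-trans π≼ν ν≼τ D D∈τ x x∈D with ν≼τ D D∈τ x x∈D
    ... | C , C∈ν , x∈C , C⊆D with π≼ν C C∈ν x x∈C
    ... | B , B∈π , x∈B , B⊆C = B , B∈π , x∈B , C⊆D ∘ B⊆C

    ≼-blocks : ∀ {π ν} → π ≼ ν → ν ≼ π → ∀ C → C ∈ᶠ blocks ν → C ∈ᶠ blocks π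
    ≼-blocks {π} {ν} π≼ν ν≼π C C∈ν with nonempty ν C∈ν
    ... | x , x∈C with π≼ν C C∈ν x x∈C
    ... | B , B∈π , x∈B , B⊆C with ν≼π B B∈π x x∈B
    ... | D , D∈ν , x∈D , D⊆B with disjoint ν C∈ν D∈ν x∈C x∈D
    ... | refl = subst (_∈ᶠ blocks π) (⊆-antisym B⊆C D⊆B) B∈π

    T-≡ : ∀ {a b : Bool} → (T a → T b) → (T b → T a) → a ≡ b
    T-≡ {false} {false} _ _ = refl
    T-≡ {false} {true}  _ g = contradiction (g _) id
    T-≡ {true}  {false} f _ = contradiction (f _) id
    T-≡ {true}  {true}  _ _ = refl

    ≼-antisym : ∀ {π ν} → π ≼ ν → ν ≼ π → π ≈ᴾ ν
    ≼-antisym {π} {ν} π≼ν ν≼π B =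
      T-≡ (≼-blocks {ν} {π} ν≼π π≼ν B) (≼-blocks {π} {ν} π≼ν ν≼π B)

NCᴬ-poset : ℕ → Poset 0ℓ 0ℓ 0ℓ
NCᴬ-poset n = record
  { Carrier = Σ (SetPartition n) Noncrossing
  ; _≈_ = _≈ᴾ_ on proj₁
  ; _≤_ = _≤ᴾ_ on proj₁
  ; isPartialOrder = record
    { isPreorder = record
      { isEquivalence = record
        { refl  = λ _ → refl
        ; sym   = λ e B → sym (e B)
        ; trans = λ e f B → trans (e B) (f B)
        }
      ; reflexive = λ {(π , _)} {(ν , _)} e → ≼⇒≤ {π = π} {ν} (≼-reflexive {π = π} {ν} e)
      ; trans = λ {(π , _)} {(ν , _)} {(τ , _)} p q → ≼⇒≤ {π = π} {τ}
          (≼-trans {π = π} {ν} {τ} (≤⇒≼ {π = π} {ν} p) (≤⇒≼ {π = ν} {τ} q))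
      }
    ; antisym = λ {(π , _)} {(ν , _)} p q →
        ≼-antisym {π = π} {ν} (≤⇒≼ {π = π} {ν} p) (≤⇒≼ {π = ν} {π} q)
    }
  }

NCᴬ : ℕ → StrictPartialOrder 0ℓ 0ℓ 0ℓ
NCᴬ n = PosetProperties.<-strictPartialOrder (NCᴬ-poset n)

Contains132 : ∀ {n} → Permutation′ n → Set
Contains132 p =
  ∃[ a ] ∃[ b ] ∃[ c ] (a < b × b < c ×
    p ⟨$⟩ʳ a < p ⟨$⟩ʳ c × p ⟨$⟩ʳ c < p ⟨$⟩ʳ b)

Avoids132 : ∀ {n} → Permutation′ n → Set
Avoids132 p = ¬ Contains132 p

-- The last position has no successor j, so it is never a descent; this is the
-- restriction i ∈ [n - 1].
Des : ∀ {n} → Permutation′ n → Pred (Fin n) 0ℓ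
Des p i = ∃[ j ] (toℕ j ≡ suc (toℕ i) × p ⟨$⟩ʳ j < p ⟨$⟩ʳ i)

private
  Des-resp : ∀ {n} {p q : Permutation′ n} → p Perm.≈ q → Des p ⊆ᴾ Des q
  Des-resp p≈q {i} (j , j≡1+i , pj<pi) = j , j≡1+i , subst₂ _<_ (p≈q j) (p≈q i) pj<pi

-- Equality is equality of one-line notations.
Pᴬ : ℕ → StrictPartialOrder 0ℓ 0ℓ 0ℓ
Pᴬ n = record
  { Carrier = Σ (Permutation′ n) Avoids132
  ; _≈_ = Perm._≈_ on proj₁
  ; _<_ = λ p q → Des (proj₁ p) ⊂ Des (proj₁ q)
  ; isStrictPartialOrder = record
    { isEquivalence = record
      { refl  = λ _ → refl
      ; sym   = λ e i → sym (e i)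
      ; trans = λ e f i → trans (e i) (f i)
      }
    ; irrefl = λ {(p , _)} {(q , _)} p≈q (_ , q⊈p) →
        q⊈p (Des-resp {p = q} {p} (λ i → sym (p≈q i)))
    ; trans = λ (p⊆q , _) (q⊆r , r⊈q) → q⊆r ∘ p⊆q , λ r⊆p → r⊈q (p⊆q ∘ r⊆p)
    ; <-resp-≈ =
        (λ {(p , _)} {(q , _)} {(r , _)} q≈r (p⊆q , q⊈p) →
          Des-resp {p = q} {r} q≈r ∘ p⊆q ,
          λ r⊆p → q⊈p (r⊆p ∘ Des-resp {p = q} {r} q≈r)) ,
        (λ {(p , _)} {(q , _)} {(r , _)} q≈r (q⊆p , p⊈q) →
          q⊆p ∘ Des-resp {p = r} {q} (λ i → sym (q≈r i)) ,
          λ p⊆r → p⊈q (Des-resp {p = r} {q} (λ i → sym (q≈r i)) ∘ p⊆r))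
    }
  }

{-# OPTIONS --safe #-}

-- Both sides are encoded by the words c₀ … cₙ₋₁ over ℕ that end in 0 and satisfy
-- cᵢ ≤ cᵢ₊₁ + 1. A 132-avoiding permutation p gives cᵢ = #{j > i : pⱼ > pᵢ}, and
-- i is a descent iff cᵢ ≤ cᵢ₊₁. A word gives the noncrossing partition in which
-- i and j share a block iff cᵢ = cⱼ is the minimum of c on the interval between
-- them, and cᵢ ≤ cᵢ₊₁ holds iff i is not the maximum of its block. So the descents
-- correspond to the non-maxima of blocks, a set that grows strictly when a
-- partition is coarsened.

module Submission where

open import Defs
open import Data.Bool.Base using (T)
open import Data.Bool.Properties using (T-≡; ⇔→≡) renaming (_≟_ to _≟ᵇ_)
open import Data.Fin.Base
  using (Fin; zero; suc; toℕ; fromℕ<; opposite; punchIn; _<_)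
open import Data.Fin.Permutation as Perm
  using (Permutation′; _⟨$⟩ʳ_; _⟨$⟩ˡ_; remove; insert)
open import Data.Fin.Properties as Fin
  using (any?; punchIn-injective; punchIn-mono-≤; punchIn-cancel-≤; toℕ-injective;
         toℕ-fromℕ<; toℕ<n; toℕ≤pred[n]; opposite-prop; opposite-involutive)
open import Data.Fin.Subset using (Subset; _∈_)
open import Data.Fin.Subset.Properties using (_∈?_; ⊆-antisym)
open import Data.Nat.Base as ℕ using (ℕ; zero; suc; z≤n; s≤s; z<s; s<s; s<s⁻¹; _≤_; _∸_)
import Data.Nat.Properties as ℕ
open import Data.Product.Base using (Σ; ∃-syntax; _×_; _,_; proj₁; proj₂)
open import Data.Sum.Base using (_⊎_; inj₁; inj₂)
open import Data.Unit.Base using (⊤; tt)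
open import Data.Vec.Base using (Vec; []; _∷_; lookup; tabulate)
open import Data.Vec.Properties
  using (≡-dec; lookup∘tabulate; []=⇒lookup; lookup⇒[]=; ∷-injectiveˡ; ∷-injectiveʳ)
open import Function.Base using (_∘_; _on_)
open import Function.Bundles using (Bijection; _⇔_; mk⇔; Equivalence)
open import Function.Properties.Equivalence using () renaming (sym to ⇔-sym)
open import Level using (0ℓ)
open import Relation.Binary.Bundles using (StrictPartialOrder)
open import Relation.Binary.Core using (Rel)
open import Relation.Binary.Definitions using (Decidable; Tri; tri<; tri≈; tri>)
open import Relation.Binary.PropositionalEquality
  using (_≡_; refl; sym; trans; cong; cong₂; subst; subst₂; module ≡-Reasoning)
open import Relation.Binary.Structures using (IsDecEquivalence)
import Relation.Binary.Construct.On as On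
open import Relation.Nullary.Decidable
  using (Dec; yes; no; map′; _×-dec_; ⌊_⌋; toWitness; fromWitness)
open import Relation.Nullary.Negation using (¬_; contradiction)
open import Relation.Unary using (_⊂_)

open Equivalence using (to; from)

private
  variable
    n : ℕ

-- The positive form of noncrossing: crossing pairs lie in one class, so no inequality of classes
-- has to be carried along.
NoncrossingRel : Rel (Fin n) 0ℓ → Set
NoncrossingRel R = ∀ {a b c d} → a < b → b < c → c < d → R a c → R b d → R a b

-- Codes

-- The largest letter that a code allows in front of this word; the value 0 on the empty word forces
-- the last letter to be 0.
height : Vec ℕ n → ℕ
height []      = 0
height (x ∷ _) = suc x

data IsCode : Vec ℕ n → Set where
  []  : IsCode []
  _∷_ : ∀ {x} {xs : Vec ℕ n} → x ≤ height xs → IsCode xs → IsCode (x ∷ xs)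

-- The entry at `i` is `k` and no earlier entry is smaller: exactly what puts `i` in one block with
-- a letter `k` placed in front of `xs`.
data Floor (k : ℕ) : Vec ℕ n → Fin n → Set where
  here  : ∀ {xs : Vec ℕ n} → Floor k (k ∷ xs) zero
  there : ∀ {x} {xs : Vec ℕ n} {i} → k ≤ x → Floor k xs i → Floor k (x ∷ xs) (suc i)

Level : Vec ℕ n → Rel (Fin n) 0ℓ
Level (x ∷ xs) zero    zero    = ⊤
Level (x ∷ xs) zero    (suc j) = Floor x xs j
Level (x ∷ xs) (suc i) zero    = Floor x xs i
Level (x ∷ xs) (suc i) (suc j) = Level xs i j

floor? : ∀ k (xs : Vec ℕ n) i → Dec (Floor k xs i)
floor? k (x ∷ xs) zero    = map′ (λ { refl → here }) (λ { here → refl }) (k ℕ.≟ x)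
floor? k (x ∷ xs) (suc i) =
  map′ (λ (k≤x , f) → there k≤x f) (λ { (there k≤x f) → k≤x , f })
       (k ℕ.≤? x ×-dec floor? k xs i)

level? : ∀ (xs : Vec ℕ n) → Decidable (Level xs)
level? (x ∷ xs) zero    zero    = yes tt
level? (x ∷ xs) zero    (suc j) = floor? x xs j
level? (x ∷ xs) (suc i) zero    = floor? x xs i
level? (x ∷ xs) (suc i) (suc j) = level? xs i j

floor-<-height : ∀ {k} {xs : Vec ℕ n} {i} → Floor k xs i → k ℕ.< height xs
floor-<-height here          = ℕ.≤-refl
floor-<-height (there k≤x _) = s≤s k≤x

floor-lookup : ∀ {k} {xs : Vec ℕ n} {i} → Floor k xs i → lookup xs i ≡ k
floor-lookup here        = refl
floor-lookup (there _ f) = floor-lookup f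

floors⇒level : ∀ {k} {xs : Vec ℕ n} {i j} → Floor k xs i → Floor k xs j → Level xs i j
floors⇒level here        here        = tt
floors⇒level here        (there _ g) = g
floors⇒level (there _ f) here        = f
floors⇒level (there _ f) (there _ g) = floors⇒level f g

-- The entry at `j` is also `k`, and entries before `j` lie either before `i` or between `i` and
-- `j`, where `k` bounds them from below.
floor-level : ∀ {k} (xs : Vec ℕ n) {i j} → Floor k xs i → Level xs i j → Floor k xs j
floor-level (x ∷ xs) {j = zero}  here          l = here
floor-level (x ∷ xs) {j = suc j} here          l = there ℕ.≤-refl l
floor-level (x ∷ xs) {j = zero}  (there k≤x f) l
  with refl ← trans (sym (floor-lookup f)) (floor-lookup l) = here
floor-level (x ∷ xs) {j = suc j} (there k≤x f) l = there k≤x (floor-level xs f l)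

-- The level relation is a noncrossing equivalence relation

level-refl : ∀ (xs : Vec ℕ n) {i} → Level xs i i
level-refl (x ∷ xs) {zero}  = tt
level-refl (x ∷ xs) {suc i} = level-refl xs

level-sym : ∀ (xs : Vec ℕ n) {i j} → Level xs i j → Level xs j i
level-sym (x ∷ xs) {zero}  {zero}  l = tt
level-sym (x ∷ xs) {zero}  {suc j} l = l
level-sym (x ∷ xs) {suc i} {zero}  l = l
level-sym (x ∷ xs) {suc i} {suc j} l = level-sym xs l

level-trans : ∀ (xs : Vec ℕ n) {i j k} → Level xs i j → Level xs j k → Level xs i k
level-trans (x ∷ xs) {zero}  {zero}          l m = m
level-trans (x ∷ xs) {zero}  {suc j} {zero}  l m = tt
level-trans (x ∷ xs) {zero}  {suc j} {suc k} l m = floor-level xs l m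
level-trans (x ∷ xs) {suc i} {zero}  {zero}  l m = l
level-trans (x ∷ xs) {suc i} {zero}  {suc k} l m = floors⇒level l m
level-trans (x ∷ xs) {suc i} {suc j} {zero}  l m = floor-level xs m (level-sym xs l)
level-trans (x ∷ xs) {suc i} {suc j} {suc k} l m = level-trans xs l m

level-isDecEquivalence : (xs : Vec ℕ n) → IsDecEquivalence (Level xs)
level-isDecEquivalence xs = record
  { isEquivalence = record
    { refl  = level-refl xs
    ; sym   = level-sym xs
    ; trans = level-trans xs
    }
  ; _≟_ = level? xs
  }

floor-mono : ∀ {k l} {xs : Vec ℕ n} {i j} → i < j → Floor k xs i → Floor l xs j → l ≤ k
floor-mono _   here        (there l≤x _) = l≤x
floor-mono i<j (there _ f) (there _ g)   = floor-mono (s<s⁻¹ i<j) f g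

-- The floor at `c` makes the entry at `b` at least `k`; as `c` lies between the level positions `b`
-- and `d`, that entry is also at most `k`.
floor-between : ∀ {k} (xs : Vec ℕ n) {b c d} → b < c → c < d →
  Floor k xs c → Level xs b d → Floor k xs b
floor-between (x ∷ xs) {zero}  {suc c} {suc d} _   c<d (there k≤x f) l
  with refl ← ℕ.≤-antisym k≤x (floor-mono (s<s⁻¹ c<d) f l) = here
floor-between (x ∷ xs) {suc b} {suc c} {suc d} b<c c<d (there k≤x f) l =
  there k≤x (floor-between xs (s<s⁻¹ b<c) (s<s⁻¹ c<d) f l)

-- Peeling off letters brings `a` to the front, where its relation to `c` is a floor and
-- `floor-between` applies.
level-noncrossing : (xs : Vec ℕ n) → NoncrossingRel (Level xs)
level-noncrossing (x ∷ xs) {zero} {suc b} {suc c} {suc d} _ b<c c<d l m =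
  floor-between xs (s<s⁻¹ b<c) (s<s⁻¹ c<d) l m
level-noncrossing (x ∷ xs) {suc a} {suc b} {suc c} {suc d} a<b b<c c<d l m =
  level-noncrossing xs (s<s⁻¹ a<b) (s<s⁻¹ b<c) (s<s⁻¹ c<d) l m

-- A code drops by at most one at a time and ends in 0, so it attains every value
-- below its height.
floor-exists : ∀ {k} {xs : Vec ℕ n} → IsCode xs → k ℕ.< height xs → ∃[ i ] Floor k xs i
floor-exists {k = k} (_∷_ {x = x} x≤h c) (s≤s k≤x) with k ℕ.≟ x
... | yes refl = zero , here
... | no  k≢x  =
  let i , f = floor-exists c (ℕ.<-≤-trans (ℕ.≤∧≢⇒< k≤x k≢x) x≤h)
  in suc i , there k≤x f

-- After `j` the word must come down through `l`, and the entries before `j`, being at least `k`, do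
-- not undercut `l`.
floor-exists-after : ∀ {k l} {xs : Vec ℕ n} {j} → IsCode xs → Floor k xs j → l ℕ.< k →
  ∃[ i ] j < i × Floor l xs i
floor-exists-after (x≤h ∷ c) here l<k =
  let i , f = floor-exists c (ℕ.<-≤-trans l<k x≤h)
  in suc i , z<s , there (ℕ.<⇒≤ l<k) f
floor-exists-after (_ ∷ c) (there k≤x f) l<k =
  let i , j<i , g = floor-exists-after c f l<k
  in suc i , s<s j<i , there (ℕ.≤-trans (ℕ.<⇒≤ l<k) k≤x) g

floor-or-enclosed : ∀ {xs : Vec ℕ n} → IsCode xs → ∀ j →
  Floor (lookup xs j) xs j ⊎
  ∃[ m ] ∃[ d ] m < j × j < d × Level xs m d × ¬ Level xs m j
floor-or-enclosed (_ ∷ c) zero = inj₁ here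
floor-or-enclosed (_∷_ {x = x} {xs} _ c) (suc j) with floor-or-enclosed c j
... | inj₂ (m , d , m<j , j<d , l , ¬l) = inj₂ (suc m , suc d , s<s m<j , s<s j<d , l , ¬l)
... | inj₁ f with ℕ.≤-<-connex (lookup xs j) x
...   | inj₁ k≤x = inj₁ (there k≤x f)
-- The new first letter undercuts the entry at `j`; the word returns to `x` later, so position 0 and
-- that return enclose `j`.
...   | inj₂ x<k =
  let d , j<d , g = floor-exists-after c f x<k
  in inj₂ (zero , suc d , z<s , s<s j<d , g , λ h → ℕ.<⇒≢ x<k (sym (floor-lookup h)))

-- The tails agree by induction. The smaller of two distinct first letters would lie below the
-- height of the common tail, hence be level with some position there, whose entry would then equal
-- both letters.
level-injective : ∀ {xs ys : Vec ℕ n} → IsCode xs → IsCode ys →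
  (∀ i j → Level xs i j ⇔ Level ys i j) → xs ≡ ys
level-injective [] [] _ = refl
level-injective (_∷_ {x = x} x≤h c) (_∷_ {x = y} y≤h d) e
  with refl ← level-injective c d (λ i j → e (suc i) (suc j)) with ℕ.<-cmp x y
... | tri≈ _ refl _ = refl
... | tri< x<y _ _ =
  let i , f = floor-exists c (ℕ.<-≤-trans x<y y≤h)
  in contradiction (trans (sym (floor-lookup f)) (floor-lookup (to (e zero (suc i)) f))) (ℕ.<⇒≢ x<y)
... | tri> _ _ y<x =
  let i , f = floor-exists c (ℕ.<-≤-trans y<x x≤h)
  in contradiction (trans (sym (floor-lookup f)) (floor-lookup (from (e zero (suc i)) f))) (ℕ.<⇒≢ y<x)

-- Induction on the restriction of `R` to the nonzero elements; only the first letter remains to be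
-- chosen.
level-surjective : (R : Rel (Fin n) 0ℓ) → IsDecEquivalence R → NoncrossingRel R →
  ∃[ xs ] IsCode xs × (∀ i j → R i j ⇔ Level xs i j)
level-surjective {zero}  R R-eq nc = [] , [] , λ ()
level-surjective {suc n} R R-eq nc
  with xs , c , e ← level-surjective (R on suc) (On.isDecEquivalence suc R-eq)
         (λ a<b b<c c<d → nc (s<s a<b) (s<s b<c) (s<s c<d))
  = extend (any? λ j → R.dec zero (suc j))
  where
  module R where
    open IsDecEquivalence R-eq public renaming (_≟_ to dec; refl to rfl; sym to symm; trans to _⊙_)

  -- 0 is only related to unenclosed elements j, as an enclosing pair m < j < d
  -- would cross the pair 0, j.
  floor-at : ∀ j → R zero (suc j) → Floor (lookup xs j) xs j
  floor-at j r with floor-or-enclosed c j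
  ... | inj₁ f = f
  ... | inj₂ (m , d , m<j , j<d , l , ¬l) =
    contradiction
      (to (e m j) (R.symm (nc z<s (s<s m<j) (s<s j<d) r (from (e m d) l)) R.⊙ r)) ¬l

  assemble : ∀ {x} → x ≤ height xs → (∀ i → R zero (suc i) ⇔ Floor x xs i) →
    ∃[ ys ] IsCode ys × (∀ i j → R i j ⇔ Level ys i j)
  assemble {x} x≤h e₀ = x ∷ xs , x≤h ∷ c , λ where
    zero    zero    → mk⇔ (λ _ → tt) (λ _ → R.rfl)
    zero    (suc j) → e₀ j
    (suc i) zero    → mk⇔ (to (e₀ i) ∘ R.symm) (R.symm ∘ from (e₀ i))
    (suc i) (suc j) → e i j

  extend : Dec (∃[ j ] R zero (suc j)) → ∃[ ys ] IsCode ys × (∀ i j → R i j ⇔ Level ys i j)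
  -- Floors are strictly below the height, so the letter `height xs` isolates 0.
  extend (no ¬r) = assemble ℕ.≤-refl λ i → mk⇔
    (λ r → contradiction (i , r) ¬r)
    (λ f → contradiction (floor-<-height f) (ℕ.<-irrefl refl))
  -- Any `j` related to 0 will do: its entry is a floor, and the floors of that value are exactly
  -- the class of `j`.
  extend (yes (j , r)) = assemble (ℕ.<⇒≤ (floor-<-height f)) λ i → mk⇔
    (λ s → floor-level xs f (to (e j i) (R.symm r R.⊙ s)))
    (λ g → r R.⊙ from (e j i) (floors⇒level f g))
    where f = floor-at j r

-- Finds the maximum of the block of `i`. A first letter below the height of the tail recurs as a
-- floor, and the search goes on from there; otherwise it is alone in its block.
level-last : ∀ {xs : Vec ℕ n} → IsCode xs → ∀ i →
  ∃[ m ] Level xs i m × (∀ {j} → m < j → ¬ Level xs m j)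
level-last (_ ∷ c) (suc i) with level-last c i
... | m , l , last = suc m , l , λ { {suc j} m<j → last (s<s⁻¹ m<j) }
level-last (_∷_ {x = x} {xs} x≤h c) zero with x ℕ.<? height xs
... | no x≮h = zero , tt , λ { {suc j} _ f → x≮h (floor-<-height f) }
... | yes x<h with i , f ← floor-exists c x<h with level-last c i
...   | m , l , last = suc m , floor-level xs f l , λ { {suc j} m<j → last (s<s⁻¹ m<j) }

NonLast : Rel (Fin n) 0ℓ → Fin n → Set
NonLast R i = ∃[ j ] i < j × R i j

-- Permutations

punchIn-mono-< : ∀ (v : Fin (suc n)) {a b} → a < b → punchIn v a < punchIn v b
punchIn-mono-< v {a} {b} a<b = ℕ.≰⇒> (ℕ.<⇒≱ a<b ∘ punchIn-cancel-≤ v b a)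

punchIn-cancel-< : ∀ (v : Fin (suc n)) {a b} → punchIn v a < punchIn v b → a < b
punchIn-cancel-< v {a} {b} a<b = ℕ.≰⇒> (ℕ.<⇒≱ a<b ∘ punchIn-mono-≤ v b a)

≤⇒<punchIn : ∀ (v : Fin (suc n)) a → toℕ v ≤ toℕ a → v < punchIn v a
≤⇒<punchIn zero    a       _   = z<s
≤⇒<punchIn (suc v) (suc a) v≤a = s<s (≤⇒<punchIn v a (ℕ.s≤s⁻¹ v≤a))

<⇒punchIn< : ∀ (v : Fin (suc n)) a → toℕ a ℕ.< toℕ v → punchIn v a < v
<⇒punchIn< (suc v) zero    _   = z<s
<⇒punchIn< (suc v) (suc a) a<v = s<s (<⇒punchIn< v a (s<s⁻¹ a<v))

<punchIn⇒≤ : ∀ (v : Fin (suc n)) a → v < punchIn v a → toℕ v ≤ toℕ a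
<punchIn⇒≤ v a v< = ℕ.≮⇒≥ (ℕ.<-asym v< ∘ <⇒punchIn< v a)

punchIn<⇒< : ∀ (v : Fin (suc n)) a → punchIn v a < v → toℕ a ℕ.< toℕ v
punchIn<⇒< v a <v = ℕ.≰⇒> (ℕ.<-asym <v ∘ ≤⇒<punchIn v a)

-- Codes of permutations

tail : Permutation′ (suc n) → Permutation′ n
tail = remove zero

-- `opposite` counts the values above the first one. Since `tail` standardizes the rest, each letter
-- counts the larger values to its right.
code : Permutation′ n → Vec ℕ n
code {zero}  p = []
code {suc n} p = toℕ (opposite (p ⟨$⟩ʳ zero)) ∷ code (tail p)

⟨$⟩ʳ-suc : ∀ (p : Permutation′ (suc n)) j →
  p ⟨$⟩ʳ suc j ≡ punchIn (p ⟨$⟩ʳ zero) (tail p ⟨$⟩ʳ j)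
⟨$⟩ʳ-suc p = Perm.punchIn-permute p zero

tail-cong : ∀ {p q : Permutation′ (suc n)} → p Perm.≈ q → tail p Perm.≈ tail q
tail-cong {p = p} {q} p≈q j = punchIn-injective (p ⟨$⟩ʳ zero) _ _ (begin
  punchIn (p ⟨$⟩ʳ zero) (tail p ⟨$⟩ʳ j) ≡⟨ ⟨$⟩ʳ-suc p j ⟨
  p ⟨$⟩ʳ suc j                          ≡⟨ p≈q (suc j) ⟩
  q ⟨$⟩ʳ suc j                          ≡⟨ ⟨$⟩ʳ-suc q j ⟩
  punchIn (q ⟨$⟩ʳ zero) (tail q ⟨$⟩ʳ j) ≡⟨ cong (λ v → punchIn v _) (p≈q zero) ⟨
  punchIn (p ⟨$⟩ʳ zero) (tail q ⟨$⟩ʳ j) ∎)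
  where open ≡-Reasoning

code-cong : ∀ {p q : Permutation′ n} → p Perm.≈ q → code p ≡ code q
code-cong {zero}  _               = refl
code-cong {suc n} {p = p} {q} p≈q =
  cong₂ _∷_ (cong (toℕ ∘ opposite) (p≈q zero)) (code-cong (tail-cong {p = p} {q} p≈q))

opposite-injective : ∀ {i j : Fin n} → opposite i ≡ opposite j → i ≡ j
opposite-injective {i = i} {j} e =
  trans (sym (opposite-involutive i)) (trans (cong opposite e) (opposite-involutive j))

code-injective : ∀ {p q : Permutation′ n} → code p ≡ code q → p Perm.≈ q
code-injective {suc n} {p} {q} e = λ where
    zero    → e₀
    (suc j) → trans (⟨$⟩ʳ-suc p j) (trans (cong₂ punchIn e₀ (tail≈ j)) (sym (⟨$⟩ʳ-suc q j)))
  where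
  e₀ = opposite-injective (toℕ-injective (∷-injectiveˡ e))
  tail≈ = code-injective {p = tail p} {tail q} (∷-injectiveʳ e)

⟨$⟩ʳ-injective : ∀ (p : Permutation′ n) {i j} → p ⟨$⟩ʳ i ≡ p ⟨$⟩ʳ j → i ≡ j
⟨$⟩ʳ-injective p e =
  trans (sym (Perm.inverseˡ p)) (trans (cong (p ⟨$⟩ˡ_) e) (Perm.inverseˡ p))

height-code : ∀ (q : Permutation′ (suc n)) → height (code q) ≡ suc n ∸ toℕ (q ⟨$⟩ʳ zero)
height-code {n} q = begin
  suc (toℕ (opposite (q ⟨$⟩ʳ zero))) ≡⟨ cong suc (opposite-prop (q ⟨$⟩ʳ zero)) ⟩
  suc (n ∸ toℕ (q ⟨$⟩ʳ zero))        ≡⟨ ℕ.+-∸-assoc 1 (toℕ≤pred[n] (q ⟨$⟩ʳ zero)) ⟨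
  suc n ∸ toℕ (q ⟨$⟩ʳ zero)          ∎
  where open ≡-Reasoning

module _ (p : Permutation′ (suc (suc n))) where
  private
    v = p ⟨$⟩ʳ zero
    q = tail p

  -- Both sides on the left are differences from `suc n`, so the order reverses. Before
  -- standardization the condition says that the second value exceeds the first by at most one.
  opposite≤height⇔ : toℕ (opposite v) ≤ height (code q) ⇔ toℕ (q ⟨$⟩ʳ zero) ≤ toℕ v
  opposite≤height⇔ rewrite opposite-prop v | height-code q =
    mk⇔ (λ le → ℕ.≮⇒≥ λ lt → ℕ.<⇒≱ (ℕ.∸-monoʳ-< lt (ℕ.<⇒≤ (toℕ<n (q ⟨$⟩ʳ zero)))) le)
        (ℕ.∸-monoʳ-≤ (suc n))

  -- The right side says that `punchIn v (q ⟨$⟩ʳ zero)`, the second value of `p`, is below `v`: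
  -- position 0 is a descent.
  opposite<height⇔ : toℕ (opposite v) ℕ.< height (code q) ⇔ toℕ (q ⟨$⟩ʳ zero) ℕ.< toℕ v
  opposite<height⇔ rewrite opposite-prop v | height-code q =
    mk⇔ (λ lt → ℕ.≰⇒> (ℕ.<⇒≱ lt ∘ ℕ.∸-monoʳ-≤ (suc n)))
        (λ lt → ℕ.∸-monoʳ-< lt (toℕ≤pred[n] v))

tail-preserves-< : ∀ (p : Permutation′ (suc n)) {i j} →
  tail p ⟨$⟩ʳ i < tail p ⟨$⟩ʳ j → p ⟨$⟩ʳ suc i < p ⟨$⟩ʳ suc j
tail-preserves-< p {i} {j} lt =
  subst₂ _<_ (sym (⟨$⟩ʳ-suc p i)) (sym (⟨$⟩ʳ-suc p j)) (punchIn-mono-< _ lt)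

tail-reflects-< : ∀ (p : Permutation′ (suc n)) {i j} →
  p ⟨$⟩ʳ suc i < p ⟨$⟩ʳ suc j → tail p ⟨$⟩ʳ i < tail p ⟨$⟩ʳ j
tail-reflects-< p {i} {j} lt =
  punchIn-cancel-< _ (subst₂ _<_ (⟨$⟩ʳ-suc p i) (⟨$⟩ʳ-suc p j) lt)

-- 132-avoidance in terms of codes

avoids-tail : ∀ {p : Permutation′ (suc n)} → Avoids132 p → Avoids132 (tail p)
avoids-tail {p = p} av (a , b , c , a<b , b<c , pa<pc , pc<pb) =
  av (suc a , suc b , suc c , s<s a<b , s<s b<c , tail-preserves-< p pa<pc , tail-preserves-< p pc<pb)

-- If the first value v were below q₀, for q the standardized tail, then 0, 1 and the
-- position in the tail of the value v would form a 132.
avoids⇒head≤ : ∀ (p : Permutation′ (suc (suc n))) → Avoids132 p →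
  toℕ (tail p ⟨$⟩ʳ zero) ≤ toℕ (p ⟨$⟩ʳ zero)
avoids⇒head≤ p av = ℕ.≮⇒≥ λ v<q₀ →
  let
    v<n = ℕ.<-trans v<q₀ (toℕ<n (q ⟨$⟩ʳ zero))
    c   = q ⟨$⟩ˡ fromℕ< v<n
    qc≡v : toℕ (q ⟨$⟩ʳ c) ≡ toℕ v
    qc≡v = trans (cong toℕ (Perm.inverseʳ q)) (toℕ-fromℕ< v<n)
    qc<q₀ = subst (ℕ._< toℕ (q ⟨$⟩ʳ zero)) (sym qc≡v) v<q₀
  in av ( zero , suc zero , suc c , z<s , s<s (pos qc<q₀)
        , subst (v <_) (sym (⟨$⟩ʳ-suc p c)) (≤⇒<punchIn v _ (ℕ.≤-reflexive (sym qc≡v)))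
        , tail-preserves-< p qc<q₀)
  where
  v = p ⟨$⟩ʳ zero
  q = tail p
  pos : ∀ {c} → q ⟨$⟩ʳ c < q ⟨$⟩ʳ zero → 0 ℕ.< toℕ c
  pos {zero}  lt = contradiction lt (ℕ.<-irrefl refl)
  pos {suc c} _  = z<s

avoids⇒isCode : ∀ (p : Permutation′ n) → Avoids132 p → IsCode (code p)
avoids⇒isCode {zero}        p av = []
avoids⇒isCode {suc zero}    p av = toℕ≤pred[n] (opposite (p ⟨$⟩ʳ zero)) ∷ []
avoids⇒isCode {suc (suc n)} p av =
  from (opposite≤height⇔ p) (avoids⇒head≤ p av) ∷
  avoids⇒isCode (tail p) (avoids-tail {p = p} av)

isCode⇒avoids : ∀ (p : Permutation′ n) → IsCode (code p) → Avoids132 p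
isCode⇒avoids {suc n} p (_ ∷ c) (suc a , suc b , suc d , a<b , b<d , pa<pd , pd<pb) =
  isCode⇒avoids (tail p) c
    (a , b , d , s<s⁻¹ a<b , s<s⁻¹ b<d , tail-reflects-< p pa<pd , tail-reflects-< p pd<pb)
-- With v the first value and q the tail, q₀ ≤ v ≤ q_d, against q_d < q₀.
isCode⇒avoids {suc (suc n)} p (x≤h ∷ c) (zero , suc zero , suc d , _ , b<d , pa<pd , pd<pb) =
  contradiction (tail-reflects-< p pd<pb) (ℕ.≤⇒≯ (ℕ.≤-trans (to (opposite≤height⇔ p) x≤h)
    (<punchIn⇒≤ _ _ (subst (p ⟨$⟩ʳ zero <_) (⟨$⟩ʳ-suc p d) pa<pd))))
isCode⇒avoids p _ (zero , suc (suc b) , suc zero , _ , s≤s () , _)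
-- Position 1 replaces position 0 as the smallest entry of the pattern, which then lies in the tail;
-- the inequality is strict because the positions differ.
isCode⇒avoids {suc (suc n)} p (x≤h ∷ c) (zero , suc (suc b) , suc (suc d) , _ , b<d , pa<pd , pd<pb) =
  isCode⇒avoids (tail p) c
    ( zero , suc b , suc d , z<s , s<s⁻¹ b<d
    , Fin.≤∧≢⇒< (ℕ.≤-trans (to (opposite≤height⇔ p) x≤h)
        (<punchIn⇒≤ _ _ (subst (p ⟨$⟩ʳ zero <_) (⟨$⟩ʳ-suc p (suc d)) pa<pd)))
        (λ e → contradiction (⟨$⟩ʳ-injective (tail p) e) λ ())
    , tail-reflects-< p pd<pb)

-- Guarantees that the letter in front of `xs` is small enough to prescribe a first value in
-- `Fin (suc n)`.
height≤length : ∀ {xs : Vec ℕ n} → IsCode xs → height xs ≤ n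
height≤length []        = z≤n
height≤length (x≤h ∷ c) = s≤s (ℕ.≤-trans x≤h (height≤length c))

code-surjective : ∀ {xs : Vec ℕ n} → IsCode xs → ∃[ p ] code p ≡ xs
code-surjective [] = Perm.id , refl
code-surjective (_∷_ {x = x} x≤h c) with q , refl ← code-surjective c =
  insert zero (opposite (fromℕ< x<1+n)) q ,
  cong₂ _∷_ (trans (cong toℕ (opposite-involutive (fromℕ< x<1+n))) (toℕ-fromℕ< x<1+n))
            (code-cong {p = tail (insert zero (opposite (fromℕ< x<1+n)) q)} {q}
              (Perm.remove-insert zero (opposite (fromℕ< x<1+n)) q))
  where
  x<1+n = s≤s (ℕ.≤-trans x≤h (height≤length c))

-- At position 0 both sides say that the first letter is below the height of the tail: a descent by
-- `opposite<height⇔`, a later element of the block by `floor-exists` and `floor-<-height`. Other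
-- positions reduce to the tail.
des⇔nonLast : ∀ (p : Permutation′ n) → IsCode (code p) → ∀ i →
  Des p i ⇔ NonLast (Level (code p)) i
des⇔nonLast {suc zero} p _ zero = mk⇔
  (λ { (zero , () , _) ; (suc () , _) })
  (λ { (zero , () , _) ; (suc () , _) })
des⇔nonLast {suc (suc n)} p (_ ∷ c) zero = mk⇔
  (λ { (suc zero , _ , lt) →
    let i , f = floor-exists c (from (opposite<height⇔ p)
                  (punchIn<⇒< _ _ (subst (_< p ⟨$⟩ʳ zero) (⟨$⟩ʳ-suc p zero) lt)))
    in suc i , z<s , f })
  (λ { (suc i , _ , f) →
    suc zero , refl , subst (_< p ⟨$⟩ʳ zero) (sym (⟨$⟩ʳ-suc p zero))
      (<⇒punchIn< _ _ (to (opposite<height⇔ p) (floor-<-height f))) })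
des⇔nonLast {suc n} p (_ ∷ c) (suc i) = mk⇔
  (λ { (suc j , e , lt) →
    let k , i<k , l = to (des⇔nonLast (tail p) c i) (j , ℕ.suc-injective e , tail-reflects-< p lt)
    in suc k , s<s i<k , l })
  (λ { (suc k , i<k , l) →
    let j , e , lt = from (des⇔nonLast (tail p) c i) (k , s<s⁻¹ i<k , l)
    in suc j , cong suc e , tail-preserves-< p lt })

-- Set partitions

SameBlock : SetPartition n → Rel (Fin n) 0ℓ
SameBlock π i j = ∃[ B ] B ∈ᶠ blocks π × i ∈ B × j ∈ B

module _ (π : SetPartition n) where

  block : Fin n → Subset n
  block i = proj₁ (cover π i)

  block∈ : ∀ i → block i ∈ᶠ blocks π
  block∈ i = proj₁ (proj₂ (cover π i))

  ∈block : ∀ i → i ∈ block i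
  ∈block i = proj₂ (proj₂ (cover π i))

  sameBlock-∈ : ∀ {i j B} → B ∈ᶠ blocks π → i ∈ B → SameBlock π i j → j ∈ B
  sameBlock-∈ B∈π i∈B (C , C∈π , i∈C , j∈C) with refl ← disjoint π B∈π C∈π i∈B i∈C = j∈C

  sameBlock-isDecEquivalence : IsDecEquivalence (SameBlock π)
  sameBlock-isDecEquivalence = record
    { isEquivalence = record
      { refl  = λ {i} → block i , block∈ i , ∈block i , ∈block i
      ; sym   = λ (B , B∈π , i∈B , j∈B) → B , B∈π , j∈B , i∈B
      ; trans = λ (B , B∈π , i∈B , j∈B) s → B , B∈π , i∈B , sameBlock-∈ B∈π j∈B s
      }
    -- By disjointness only the chosen block of `i` has to be tested.
    ; _≟_ = λ i j → map′ (λ j∈ → block i , block∈ i , ∈block i , j∈)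
                         (sameBlock-∈ (block∈ i) (∈block i)) (j ∈? block i)
    }

  sameBlock-noncrossing : Noncrossing π → NoncrossingRel (SameBlock π)
  sameBlock-noncrossing nc {a} {b} {c} {d} a<b b<c c<d (B , B∈π , a∈B , c∈B) (C , C∈π , b∈C , d∈C)
    with ≡-dec _≟ᵇ_ B C
  ... | yes refl = B , B∈π , a∈B , b∈C
  ... | no  B≢C  = contradiction
    (a , b , c , d , a<b , b<c , c<d , B , C , B∈π , C∈π , B≢C , a∈B , c∈B , b∈C , d∈C) nc

-- `B` has a point `i`, and the `ν`-block of `i` has the same elements as `B` because the two
-- relations agree.
sameBlock⇒blocks⊆ : ∀ (π ν : SetPartition n) → (∀ i j → SameBlock π i j ⇔ SameBlock ν i j) →
  ∀ {B} → B ∈ᶠ blocks π → B ∈ᶠ blocks ν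
sameBlock⇒blocks⊆ π ν e {B} B∈π with i , i∈B ← nonempty π B∈π =
  subst (_∈ᶠ blocks ν)
    (⊆-antisym
      (λ j∈ → sameBlock-∈ π B∈π i∈B (from (e i _) (block ν i , block∈ ν i , ∈block ν i , j∈)))
      (λ j∈B → sameBlock-∈ ν (block∈ ν i) (∈block ν i) (to (e i _) (B , B∈π , i∈B , j∈B))))
    (block∈ ν i)

sameBlock⇒≈ᴾ : ∀ (π ν : SetPartition n) → (∀ i j → SameBlock π i j ⇔ SameBlock ν i j) → π ≈ᴾ ν
sameBlock⇒≈ᴾ π ν e B = ⇔→≡ (mk⇔
  (to T-≡ ∘ sameBlock⇒blocks⊆ π ν e ∘ from T-≡)
  (to T-≡ ∘ sameBlock⇒blocks⊆ ν π (λ i j → ⇔-sym (e i j)) ∘ from T-≡))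

≈ᴾ⇒sameBlock : ∀ (π ν : SetPartition n) → π ≈ᴾ ν → ∀ {i j} → SameBlock π i j → SameBlock ν i j
≈ᴾ⇒sameBlock π ν e (B , B∈π , i∈B , j∈B) = B , subst T (e B) B∈π , i∈B , j∈B

≤ᴾ⇒sameBlock : ∀ (π ν : SetPartition n) → π ≤ᴾ ν → ∀ {i j} → SameBlock π i j → SameBlock ν i j
≤ᴾ⇒sameBlock π ν π≤ν {i} {j} s with 𝓕 , 𝓕⊆π , ⋃𝓕 ← π≤ν (block ν i) (block∈ ν i)
  with B , B∈𝓕 , i∈B ← to (⋃𝓕 i) (∈block ν i) =
  block ν i , block∈ ν i , ∈block ν i ,
  from (⋃𝓕 j) (B , B∈𝓕 , sameBlock-∈ π (𝓕⊆π B B∈𝓕) i∈B s)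

-- Set partitions into equivalence classes

module _ {R : Rel (Fin n) 0ℓ} (R-eq : IsDecEquivalence R) where
  private
    module R = IsDecEquivalence R-eq

  class : Fin n → Subset n
  class i = tabulate λ j → ⌊ i R.≟ j ⌋

  ∈class⇔ : ∀ {i j} → j ∈ class i ⇔ R i j
  ∈class⇔ {i} {j} = mk⇔
    (λ j∈ → toWitness {a? = i R.≟ j} (from T-≡ (trans (sym (lookup∘tabulate _ j)) ([]=⇒lookup j∈))))
    (λ r → lookup⇒[]= j _ (trans (lookup∘tabulate _ j) (to T-≡ (fromWitness {a? = i R.≟ j} r))))

  class-cong : ∀ {i j} → R i j → class i ≡ class j
  class-cong r = ⊆-antisym
    (λ k∈ → from ∈class⇔ (R.trans (R.sym r) (to ∈class⇔ k∈)))
    (λ k∈ → from ∈class⇔ (R.trans r (to ∈class⇔ k∈)))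

  isClass? : ∀ B → Dec (∃[ i ] class i ≡ B)
  isClass? B = any? λ i → ≡-dec _≟ᵇ_ (class i) B

  classes : SetPartition n
  classes = record
    { blocks   = λ B → ⌊ isClass? B ⌋
    ; nonempty = λ {B} B∈ → let i , e = toWitness {a? = isClass? B} B∈ in
        i , subst (i ∈_) e (from ∈class⇔ R.refl)
    ; cover    = λ i → class i , fromWitness {a? = isClass? (class i)} (i , refl) , from ∈class⇔ R.refl
    ; disjoint = λ {B} {C} B∈ C∈ → meet (toWitness {a? = isClass? B} B∈) (toWitness {a? = isClass? C} C∈)
    }
    where
    meet : ∀ {B C x} → ∃[ i ] class i ≡ B → ∃[ j ] class j ≡ C → x ∈ B → x ∈ C → B ≡ C
    meet (i , refl) (j , refl) x∈B x∈C =
      class-cong (R.trans (to ∈class⇔ x∈B) (R.sym (to ∈class⇔ x∈C)))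

  sameBlock-classes : ∀ i j → SameBlock classes i j ⇔ R i j
  sameBlock-classes i j = mk⇔
    (to ∈class⇔ ∘ sameBlock-∈ classes (block∈ classes i) (∈block classes i))
    (λ r → block classes i , block∈ classes i , ∈block classes i , from ∈class⇔ r)

  classes-noncrossing : NoncrossingRel R → Noncrossing classes
  classes-noncrossing nc (a , b , c , d , a<b , b<c , c<d , B , C , B∈ , C∈ , B≢C , a∈B , c∈B , b∈C , d∈C) =
    B≢C (disjoint classes B∈ C∈
      (sameBlock-∈ classes B∈ a∈B (from (sameBlock-classes a b)
        (nc a<b b<c c<d (to (sameBlock-classes a c) (B , B∈ , a∈B , c∈B))
                        (to (sameBlock-classes b d) (C , C∈ , b∈C , d∈C)))))
      b∈C)

-- The bijection and its monotonicity

Encodes : SetPartition n → Permutation′ n → Set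
Encodes π p = ∀ i j → SameBlock π i j ⇔ Level (code p) i j

encoding : ((π , _) : Σ (SetPartition n) Noncrossing) →
  ∃[ p ] IsCode (code p) × Encodes π p
encoding (π , nc)
  with xs , c , e ← level-surjective (SameBlock π) (sameBlock-isDecEquivalence π)
                      (sameBlock-noncrossing π nc)
  with p , refl ← code-surjective c = p , c , e

-- A non-maximum of a block stays one after coarsening, which gives the inclusion. If the descent
-- sets were equal, all pairs related in `τ` would be related in `π`, making the partitions equal.
refines⇒Des⊂ : ∀ {π τ : SetPartition n} {p q : Permutation′ n} →
  IsCode (code p) → IsCode (code q) → Encodes π p → Encodes τ q →
  π ≤ᴾ τ → ¬ π ≈ᴾ τ → Des p ⊂ Des q
refines⇒Des⊂ {π = π} {τ} {p} {q} cp cq ep eq π≤τ π≉τ =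
  (λ {i} d → from (des⇔nonLast q cq i)
    (let j , i<j , l = to (des⇔nonLast p cp i) d in j , i<j , coarsen l)) ,
  λ q⊆p → π≉τ (sameBlock⇒≈ᴾ π τ λ i j → mk⇔ (≤ᴾ⇒sameBlock π τ π≤τ)
    (λ s → from (ep i j) (refine q⊆p (to (eq i j) s))))
  where
  coarsen : ∀ {i j} → Level (code p) i j → Level (code q) i j
  coarsen l = to (eq _ _) (≤ᴾ⇒sameBlock π τ π≤τ (from (ep _ _) l))

  -- The maxima of the π-blocks of i and j are maxima of the same τ-block, hence equal.
  refine : (∀ {i} → Des q i → Des p i) → ∀ {i j} → Level (code q) i j → Level (code p) i j
  refine q⊆p {i} {j} l with level-last cp i | level-last cp j
  ... | a , ia , a-last | b , jb , b-last = conclude (Fin.<-cmp a b)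
    where
    P = code p
    Q = code q

    ab : Level Q a b
    ab = level-trans Q (level-sym Q (coarsen ia)) (level-trans Q l (coarsen jb))

    not-nonLast : ∀ {m} → (∀ {k} → m < k → ¬ Level P m k) → ¬ NonLast (Level Q) m
    not-nonLast {m} m-last nl =
      let k , m<k , mk = to (des⇔nonLast p cp m) (q⊆p (from (des⇔nonLast q cq m) nl))
      in m-last m<k mk

    conclude : Tri (a < b) (a ≡ b) (b < a) → Level P i j
    conclude (tri< a<b _ _)  = contradiction (b , a<b , ab) (not-nonLast a-last)
    conclude (tri≈ _ refl _) = level-trans P ia (level-sym P jb)
    conclude (tri> _ _ b<a)  = contradiction (a , b<a , level-sym Q ab) (not-nonLast b-last)

theorem1 : (n : ℕ) → 1 ≤ n →
    let module NC = StrictPartialOrder (NCᴬ n)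
        module P  = StrictPartialOrder (Pᴬ n)
    in Σ (Bijection NC.Eq.setoid P.Eq.setoid) λ φ →
         ∀ (π τ : NC.Carrier) → π NC.< τ → Bijection.to φ π P.< Bijection.to φ τ
theorem1 n _ = φ , λ π τ (π≤τ , π≉τ) →
    refines⇒Des⊂ {π = proj₁ π} {proj₁ τ} {perm π} {perm τ}
      (isCode π) (isCode τ) (encodes π) (encodes τ) π≤τ π≉τ
  where
  module NC = StrictPartialOrder (NCᴬ n)
  module P  = StrictPartialOrder (Pᴬ n)

  perm : NC.Carrier → Permutation′ n
  perm π = proj₁ (encoding π)

  isCode : ∀ π → IsCode (code (perm π))
  isCode π = proj₁ (proj₂ (encoding π))

  encodes : ∀ π → Encodes (proj₁ π) (perm π)
  encodes π = proj₂ (proj₂ (encoding π))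

  φ : Bijection NC.Eq.setoid P.Eq.setoid
  φ = record
    { to        = λ π → perm π , isCode⇒avoids (perm π) (isCode π)
    ; cong      = λ {π} {τ} → perm-cong {π} {τ}
    ; bijective = (λ {π} {τ} → perm-injective {π} {τ}) , λ (p , av) →
        let c  = avoids⇒isCode p av
            eq = level-isDecEquivalence (code p)
        -- The preimage of `p` consists of the level classes of its code. Any `τ` with these blocks
        -- has the same level relation, hence the same code and permutation.
        in (classes eq , classes-noncrossing eq (level-noncrossing (code p))) ,
           λ {τ} τ≈ → code-injective {p = perm τ} {p} (level-injective (isCode τ) c λ i j → mk⇔
             (to (sameBlock-classes eq i j) ∘ ≈ᴾ⇒sameBlock (proj₁ τ) (classes eq) τ≈
               ∘ from (encodes τ i j))
             (to (encodes τ i j) ∘ ≈ᴾ⇒sameBlock (classes eq) (proj₁ τ) (sym ∘ τ≈)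
               ∘ from (sameBlock-classes eq i j)))
    }
    where
    -- `encoding` takes the proof fields as input too, but a code is determined by its level
    -- relation, so only the blocks matter.
    perm-cong : ∀ {π τ} → π NC.≈ τ → perm π Perm.≈ perm τ
    perm-cong {π} {τ} π≈τ = code-injective {p = perm π} {perm τ}
      (level-injective (isCode π) (isCode τ) λ i j → mk⇔
        (to (encodes τ i j) ∘ ≈ᴾ⇒sameBlock (proj₁ π) (proj₁ τ) π≈τ ∘ from (encodes π i j))
        (to (encodes π i j) ∘ ≈ᴾ⇒sameBlock (proj₁ τ) (proj₁ π) (sym ∘ π≈τ) ∘ from (encodes τ i j)))

    perm-injective : ∀ {π τ} → perm π Perm.≈ perm τ → π NC.≈ τ
    perm-injective {π} {τ} e = sameBlock⇒≈ᴾ (proj₁ π) (proj₁ τ) λ i j → mk⇔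
        (from (encodes τ i j) ∘ subst (λ xs → Level xs i j) codes≡ ∘ to (encodes π i j))
        (from (encodes π i j) ∘ subst (λ xs → Level xs i j) (sym codes≡) ∘ to (encodes τ i j))
      where
      codes≡ = code-cong {p = perm π} {perm τ} e
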